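{- Let $k\ge 1$. A connected graph $G$ is well-hued with sequence $(2,4,6,\dots,2k,2k+1)$ if and only if $G$ is formed in the following way: (1) $G$ is obtained from a vertex $c$ together with a graph $G_1$ of order $2k$ (so $V(G)=V(G_1)\cup\{c\}$ and $G_1=G-c$), where $G_1$ is a spanning subgraph of the complete $k$-partite graph $K_{2,\dots,2}$ (with $k$ partite sets of size $2$) and $\alpha(G_1)=2$; (2) the set $S=V(G_1)-N_G[c]$ is nonempty and is an independent $\mathcal{M}$-alternating dominating set in $\overline{G_1}$, where $\mathcal{M}$ is the perfect matching of $\overline{G_1}$ whose edges are the $k$ partite sets of $K_{2,\dots,2}$.
   Context: All graphs are finite and simple. For $j\ge 1$, a maximal $j$-colorable subgraph of $G$ is a subgraph induced by a set $S\subseteq V(G)$ such that $G[S]$ is (properly) $j$-colorable and $G[S']$ is not $j$-colorable for every $S'$ with $S\subsetneq S'\subseteq V(G)$. $G$ is well-hued if for every $j\ge 1$ all maximal $j$-colorable subgraphs of $G$ have the same order, denoted $a_j$. The sequence of a well-hued graph $G$ is written $(a_1,a_2,\dots,a_{\chi(G)})$, where $a_{\chi(G)}=|V(G)|$. $\overline{H}$ is the complement of $H$, $\alpha$ the independence number, $N_G[c]$ the closed neighborhood. Given a matching $\mathcal{M}$ in a graph $H$, a path $P$ in $H$ is an $(\mathcal{M},E(H)-\mathcal{M})$-alternating path if no two consecutive edges of $P$ are both in $\mathcal{M}$ and no two consecutive edges are both in $E(H)-\mathcal{M}$. If $\mathcal{M}$ is a perfect matching of $H$, a set $S\subseteq V(H)$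 is an $\mathcal{M}$-alternating dominating set of $H$ if every vertex $v\in V(H)$ is either in $S$ or lies on an $(\mathcal{M},E(H)-\mathcal{M})$-alternating path that originates at some vertex $u\in S$ and begins with the edge of $\mathcal{M}$ incident to $u$. It is independent if no two vertices of $S$ are adjacent in $H$. -}

module Defs where

open import Data.Nat.Base using (ℕ; suc; _≤_; _≥_; _*_)
open import Data.Fin.Base as Fin using (Fin; zero; suc; toℕ; quotient; remainder; combine; opposite)
open import Data.Fin.Properties as Fin
  using (remQuot-combine; combine-remQuot)
open import Data.Fin.Subset using (Subset; _∈_; _⊂_; ∣_∣; ⊤; _-_)
open import Data.List.Base using (List; []; _∷_; length; lookup)
import Data.List.Membership.Propositional as List
open import Data.List.Relation.Unary.Linked using (Linked)
open import Data.List.Relation.Unary.Unique.Propositional using (Unique)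
open import Data.Product using (Σ-syntax; ∃; ∃!; _×_; _,_; proj₁; proj₂)
open import Data.Sum.Base using (_⊎_)
open import Function.Bundles using (_⇔_; _↔_; module Inverse)
open import Level using (0ℓ)
open import Relation.Binary.Construct.Closure.ReflexiveTransitive using (Star)
open import Relation.Binary.Core using (Rel; _⇒_)
open import Relation.Binary.Definitions using (Decidable; Symmetric; Irreflexive)
open import Relation.Binary.PropositionalEquality
  using (_≡_; _≢_; refl; sym; trans; cong; cong₂; ≢-sym)
open import Relation.Nullary using (¬_; ¬?; contradiction)
open import Relation.Nullary.Decidable using (_×-dec_)
open import Relation.Unary using (Pred; Satisfiable)

-- Adjacency is required to be decidable, as it classically always is.
record Graph (V : Set) : Set₁ where
  field
    Adj       : Rel V 0ℓ
    adj?      : Decidable Adj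
    symmetric : Symmetric Adj
    irrefl    : Irreflexive _≡_ Adj

open Graph public using (Adj; adj?)

private
  variable
    V W : Set
    n : ℕ

Connected : Graph V → Set
Connected G = ∀ u v → Star (Adj G) u v

complement : Graph (Fin n) → Graph (Fin n)
complement G = record
  { Adj       = λ u v → u ≢ v × ¬ Adj G u v
  ; adj?      = λ u v → ¬? (u Fin.≟ v) ×-dec ¬? (adj? G u v)
  ; symmetric = λ { (u≢v , u≁v) → ≢-sym u≢v , λ v∼u → u≁v (Graph.symmetric G v∼u) }
  ; irrefl    = λ { u≡v (u≢v , _) → u≢v u≡v }
  }

-- Proofs of v ∈ S are unique, so vertices are not duplicated.
_[_] : Graph (Fin n) → (S : Subset n) → Graph (∃ λ v → v ∈ S)
G [ S ] = record
  { Adj       = λ u v → Adj G (proj₁ u) (proj₁ v)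
  ; adj?      = λ u v → adj? G (proj₁ u) (proj₁ v)
  ; symmetric = Graph.symmetric G
  ; irrefl    = λ u≡v → Graph.irrefl G (cong proj₁ u≡v)
  }

infix 4 _≅_ _⊑_

record _≅_ (G : Graph V) (H : Graph W) : Set where
  field
    bijection : V ↔ W
  open Inverse bijection public using (to; from)
  field
    preserves : ∀ u v → Adj G u v ⇔ Adj H (to u) (to v)

-- Only spanning subgraphs: the vertex set is shared.
_⊑_ : Graph V → Graph V → Set
G ⊑ H = Adj G ⇒ Adj H

ClosedNeighbourhood : Graph V → V → Pred V 0ℓ
ClosedNeighbourhood G c v = v ≡ c ⊎ Adj G c v

Independent : Graph V → Pred V 0ℓ → Set
Independent G P = ∀ u v → P u → P v → ¬ Adj G u v

record IsIndependenceNumber (G : Graph (Fin n)) (a : ℕ) : Set where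
  field
    attained : Σ[ T ∈ Subset n ] (Independent G (_∈ T) × ∣ T ∣ ≡ a)
    maximum  : ∀ T → Independent G (_∈ T) → ∣ T ∣ ≤ a

-- K_{m,…,m} with k partite sets; `quotient m v` is the index of the
-- partite set containing v.
completeMultipartite : ∀ k m → Graph (Fin (k * m))
completeMultipartite k m = record
  { Adj       = λ u v → quotient {k} m u ≢ quotient {k} m v
  ; adj?      = λ u v → ¬? (quotient {k} m u Fin.≟ quotient {k} m v)
  ; symmetric = ≢-sym
  ; irrefl    = λ u≡v u∼v → u∼v (cong (quotient {k} m) u≡v)
  }

Colourable : Graph V → ℕ → Set
Colourable {V} G j =
  Σ[ colour ∈ (V → Fin j) ] (∀ u v → Adj G u v → colour u ≢ colour v)

record IsChromaticNumber (G : Graph V) (χ : ℕ) : Set where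
  field
    colourable : Colourable G χ
    minimum    : ∀ j → Colourable G j → χ ≤ j

record MaximalColourable (G : Graph (Fin n)) (j : ℕ) (S : Subset n) : Set where
  field
    colourable : Colourable (G [ S ]) j
    maximal    : ∀ S′ → S ⊂ S′ → ¬ Colourable (G [ S′ ]) j

WellHued : Graph (Fin n) → Set
WellHued G = ∀ j → j ≥ 1 → ∀ S T →
  MaximalColourable G j S → MaximalColourable G j T → ∣ S ∣ ≡ ∣ T ∣

-- The list as is (a₁ , a₂ , … , a_χ₍G₎), so its entry at (0-based)
-- position i is a_{i+1}.
record WellHuedWithSequence (G : Graph (Fin n)) (as : List ℕ) : Set where
  field
    wellHued        : WellHued G
    chromaticNumber : IsChromaticNumber G (length as)
    orders          : ∀ (i : Fin (length as)) S →
                      MaximalColourable G (suc (toℕ i)) S → ∣ S ∣ ≡ lookup as i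

-- A perfect matching, as the symmetric relation "uv is a matching edge".
record PerfectMatching (H : Graph V) : Set₁ where
  field
    Matched   : Rel V 0ℓ
    symmetric : Symmetric Matched
    edges     : Matched ⇒ Adj H
    perfect   : ∀ u → ∃! _≡_ (Matched u)

open PerfectMatching public using (Matched)

data Alternating (A B : Rel V 0ℓ) : List V → Set where
  []    : Alternating A B []
  [-]   : ∀ {u} → Alternating A B (u ∷ [])
  [-,-] : ∀ {u v} → Alternating A B (u ∷ v ∷ [])
  step  : ∀ {u v w vs} → ¬ (A u v × A v w) → ¬ (B u v × B v w) →
          Alternating A B (v ∷ w ∷ vs) → Alternating A B (u ∷ v ∷ w ∷ vs)

IsPath : Graph V → List V → Set
IsPath H vs = Linked (Adj H) vs × Unique vs

IsAlternatingPath : (H : Graph V) → PerfectMatching H → List V → Set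
IsAlternatingPath H M vs =
  IsPath H vs ×
  Alternating (Matched M) (λ u v → Adj H u v × ¬ Matched M u v) vs

AlternatingDominating : (H : Graph V) → PerfectMatching H → Pred V 0ℓ → Set
AlternatingDominating {V} H M S = ∀ v → S v ⊎
  (Σ[ u ∈ V ] Σ[ w ∈ V ] Σ[ vs ∈ List V ]
    (S u × Matched M u w × IsAlternatingPath H M (u ∷ w ∷ vs) × v List.∈ u ∷ w ∷ vs))

opposite-≢ : (x : Fin 2) → opposite x ≢ x
opposite-≢ zero       ()
opposite-≢ (suc zero) ()

opposite-unique : (x y : Fin 2) → x ≢ y → opposite x ≡ y
opposite-unique zero       zero       x≢y = contradiction refl x≢y
opposite-unique zero       (suc zero) x≢y = refl
opposite-unique (suc zero) zero       x≢y = refl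
opposite-unique (suc zero) (suc zero) x≢y = contradiction refl x≢y

mate : ∀ k → Fin (k * 2) → Fin (k * 2)
mate k v = combine (quotient {k} 2 v) (opposite (remainder {k} 2 v))

quotient-mate : ∀ k v → quotient 2 (mate k v) ≡ quotient {k} 2 v
quotient-mate k v = cong proj₁ (remQuot-combine (quotient {k} 2 v) _)

mate-≢ : ∀ k v → v ≢ mate k v
mate-≢ k v v≡mate = opposite-≢ (remainder {k} 2 v) (sym (trans
  (cong (remainder {k} 2) v≡mate)
  (cong proj₂ (remQuot-combine (quotient {k} 2 v) _))))

mate-unique : ∀ k v {w} → v ≢ w → quotient {k} 2 v ≡ quotient {k} 2 w → mate k v ≡ w
mate-unique k v {w} v≢w q≡q = trans
  (cong₂ combine q≡q (opposite-unique _ _ λ r≡r → v≢w (trans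
    (sym (combine-remQuot {k} 2 v))
    (trans (cong₂ combine q≡q r≡r) (combine-remQuot {k} 2 w)))))
  (combine-remQuot {k} 2 w)

-- Its edges are the k partite sets of K_{2,…,2}.
partiteMatching : ∀ k (G : Graph (Fin (k * 2))) → G ⊑ completeMultipartite k 2 →
                  PerfectMatching (complement G)
partiteMatching k G G⊑K = record
  { Matched   = λ u v → u ≢ v × quotient {k} 2 u ≡ quotient {k} 2 v
  ; symmetric = λ { (u≢v , q≡q) → ≢-sym u≢v , sym q≡q }
  ; edges     = λ { (u≢v , q≡q) → u≢v , λ u∼v → G⊑K u∼v q≡q }
  ; perfect   = λ u → mate k u , (mate-≢ k u , sym (quotient-mate k u)) ,
                      λ { (u≢w , q≡q) → mate-unique k u u≢w q≡q }
  }

-- Relabelling the vertices of G - c along G₁≅G-c lets K_{2,…,2} be the fixed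
-- graph on Fin (k * 2).
record FormedByConstruction (k : ℕ) (G : Graph (Fin n)) : Set₁ where
  field
    c         : Fin n
    G₁        : Graph (Fin (k * 2))
    G₁≅G-c    : G₁ ≅ G [ ⊤ - c ]
    spanning  : G₁ ⊑ completeMultipartite k 2
    α[G₁]≡2   : IsIndependenceNumber G₁ 2

  S : Pred (Fin (k * 2)) 0ℓ
  S v = ¬ ClosedNeighbourhood G c (proj₁ (_≅_.to G₁≅G-c v))

  M : PerfectMatching (complement G₁)
  M = partiteMatching k G₁ spanning

  field
    nonempty    : Satisfiable S
    independent : Independent (complement G₁) S
    dominating  : AlternatingDominating (complement G₁) M S

{-# OPTIONS --safe #-}

-- In the complement of a graph without independent triples, a colouring is a family of
-- disjoint vertices and edges.
--
-- From the construction to the sequence: let f colour S with j ≤ k colours and ∣S∣ < 2j.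
-- Either a colour is unused, or some vertex v of S is alone in its class. Each w outside S
-- is equal or non-adjacent in G to the vertex x missed by some near-perfect matching P of
-- the complement: M misses c, and swapping edges along an alternating path from c moves
-- the missed vertex along that path. Walking along the symmetric difference of P and the
-- colour classes moves the lone vertex from v to x, whose class can then take in w. So S
-- is not maximal.
--
-- From the sequence to the construction: a k-colourable set with 2k vertices misses a
-- single vertex c, and its colour classes are the partite sets. Suppose that m partite
-- sets have been reached by alternating paths and let Y be their union with c. Then Y has
-- 2m+1 vertices and is (m+1)-colourable, hence not maximal, so some Y ∪ {w} has an
-- (m+1)-colouring, all of whose classes are pairs. Alternating between these pairs and
-- partite sets leads from w to c without leaving Y ∪ {w}, and reversing the walk gives a
-- path that reaches w and its mate.

module Submission where

open import Defs
open import Data.Nat.Base as ℕ using (ℕ; suc; _+_; _*_; _≥_; _≤_; _<_; s≤s; z≤n)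
import Data.Nat.Properties as ℕ
open import Data.Fin.Base as Fin
  using (Fin; zero; suc; toℕ; combine; quotient; remainder; opposite; punchOut; finToFun; funToFin)
open import Data.Fin.Properties as Fin using (any?; all?)
open import Data.Fin.Subset
  using (Subset; inside; outside; _∈_; _∉_; _⊆_; _⊂_; _⊃_; _∪_; ⁅_⁆; ∣_∣; ⊤; ⊥; _-_)
open import Data.Fin.Subset.Properties
open import Data.Fin.Subset.Induction using (Acc; acc; ⊃-wellFounded)
open import Data.List.Base using (List; []; _∷_; length; lookup; applyUpTo; _∷ʳ_)
open import Data.List.Properties using (length-++; length-applyUpTo)
import Data.List.Membership.Propositional as List
open import Data.List.Relation.Unary.All as All using (All; []; _∷_)
open import Data.List.Relation.Unary.AllPairs using ([]; _∷_)
open import Data.List.Relation.Unary.Any using (here; there)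
open import Data.List.Relation.Unary.Linked using (Linked; [-]; _∷_)
open import Data.List.Relation.Unary.Unique.Propositional using (Unique)
open import Data.Product using (Σ-syntax; ∃; _×_; _,_; proj₁; proj₂)
open import Data.Sum.Base as Sum using (_⊎_; inj₁; inj₂)
open import Data.Vec.Base using (here; there; _∷_)
open import Data.Vec.Functional using (updateAt)
open import Data.Vec.Functional.Properties using (updateAt-updates; updateAt-minimal)
open import Data.Vec.Properties.WithK using ([]=-irrelevant)
open import Function.Base using (_∘_; const; id)
open import Function.Bundles using (_⇔_; mk⇔; mk↔ₛ′; module Equivalence; module Inverse)
open import Function.Definitions using (Injective)
open import Relation.Binary.Definitions using (tri<; tri≈; tri>)
open import Relation.Binary.PropositionalEquality hiding ([_])
open import Relation.Nullary using (¬_; Dec; yes; no; contradiction; ¬?)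
open import Relation.Nullary.Decidable using (_×-dec_; _→-dec_; map′)

private variable
  m n j : ℕ
  u v w x : Fin n
  S : Subset n

-- Finite sets

element : (S : Subset n) → Fin ∣ S ∣ → Fin n
element (inside  ∷ S) zero    = zero
element (inside  ∷ S) (suc i) = suc (element S i)
element (outside ∷ S) i       = suc (element S i)

element∈ : ∀ (S : Subset n) i → element S i ∈ S
element∈ (inside  ∷ S) zero    = here
element∈ (inside  ∷ S) (suc i) = there (element∈ S i)
element∈ (outside ∷ S) i       = there (element∈ S i)

element-injective : (S : Subset n) → Injective _≡_ _≡_ (element S)
element-injective (inside  ∷ S) {zero}  {zero}  _  = refl
element-injective (inside  ∷ S) {suc _} {suc _} eq =
  cong suc (element-injective S (Fin.suc-injective eq))
element-injective (outside ∷ S) eq = element-injective S (Fin.suc-injective eq)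

position : (S : Subset n) → v ∈ S → Fin ∣ S ∣
position (inside  ∷ S) here      = zero
position (inside  ∷ S) (there p) = suc (position S p)
position (outside ∷ S) (there p) = position S p

element-position : ∀ (S : Subset n) (v∈S : v ∈ S) → element S (position S v∈S) ≡ v
element-position (inside  ∷ S) here      = refl
element-position (inside  ∷ S) (there p) = cong suc (element-position S p)
element-position (outside ∷ S) (there p) = cong suc (element-position S p)

injectiveOn⇒∣∣≤ : ∀ (S : Subset n) (f : Fin n → Fin m) →
  (∀ {u v} → u ∈ S → v ∈ S → f u ≡ f v → u ≡ v) → ∣ S ∣ ≤ m
injectiveOn⇒∣∣≤ S f inj = Fin.injective⇒≤ {f = f ∘ element S} λ eq →
  element-injective S (inj (element∈ S _) (element∈ S _) eq)

injectiveInto⇒≤∣∣ : ∀ (S : Subset n) (f : Fin m → Fin n) →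
  (∀ i → f i ∈ S) → Injective _≡_ _≡_ f → m ≤ ∣ S ∣
injectiveInto⇒≤∣∣ S f f∈S inj = Fin.injective⇒≤ {f = position S ∘ f∈S} λ {i} {k} eq → inj
  (trans (sym (element-position S (f∈S i)))
  (trans (cong (element S) eq) (element-position S (f∈S k))))

injective⇒surjective : ∀ {f : Fin m → Fin n} → Injective _≡_ _≡_ f → m ≡ n → ∀ y → ∃ λ x → f x ≡ y
injective⇒surjective {n = suc n} {f} inj refl y with any? (λ x → f x Fin.≟ y)
... | yes hit = hit
... | no miss = contradiction
  (Fin.injective⇒≤ {f = λ x → punchOut (y≢f x)}
    λ {a} {b} eq → inj (Fin.punchOut-injective (y≢f a) (y≢f b) eq))
  ℕ.1+n≰n
  where
  y≢f : ∀ x → y ≢ f x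
  y≢f x eq = miss (x , sym eq)

injectiveOn⇒surjective : ∀ (S : Subset n) (f : Fin n → Fin m) →
  (∀ {u v} → u ∈ S → v ∈ S → f u ≡ f v → u ≡ v) → ∣ S ∣ ≡ m → ∀ y → ∃ λ x → x ∈ S × f x ≡ y
injectiveOn⇒surjective S f inj ∣S∣≡m y =
  let i , eq = injective⇒surjective {f = f ∘ element S}
                 (λ eq → element-injective S (inj (element∈ S _) (element∈ S _) eq)) ∣S∣≡m y
  in element S i , element∈ S i , eq

∈-insertˡ : v ∈ S → v ∈ S ∪ ⁅ w ⁆
∈-insertˡ = p⊆p∪q _

∈-insertʳ : v ∈ S ∪ ⁅ v ⁆
∈-insertʳ {S = S} = q⊆p∪q S _ (x∈⁅x⁆ _)

∈-insert⁻ : v ∈ S ∪ ⁅ w ⁆ → v ∈ S ⊎ v ≡ w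
∈-insert⁻ {S = S} {w = w} v∈ with x∈p∪q⁻ S ⁅ w ⁆ v∈
... | inj₁ v∈S = inj₁ v∈S
... | inj₂ v∈w = inj₂ (x∈⁅y⁆⇒x≡y w v∈w)

⊂-insert : w ∉ S → S ⊂ S ∪ ⁅ w ⁆
⊂-insert w∉S = ∈-insertˡ , _ , ∈-insertʳ , w∉S

∣insert∣ : ∀ (S : Subset n) → w ∉ S → ∣ S ∪ ⁅ w ⁆ ∣ ≡ suc ∣ S ∣
∣insert∣ {w = zero}  (inside  ∷ S) w∉S = contradiction here w∉S
∣insert∣ {w = zero}  (outside ∷ S) _   = cong (suc ∘ ∣_∣) (∪-identityʳ S)
∣insert∣ {w = suc w} (inside  ∷ S) w∉S = cong suc (∣insert∣ S (w∉S ∘ there))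
∣insert∣ {w = suc w} (outside ∷ S) w∉S = ∣insert∣ S (w∉S ∘ there)

∣S∣<n⇒∃∉ : ∀ (S : Subset n) → ∣ S ∣ < n → ∃ λ w → w ∉ S
∣S∣<n⇒∃∉ {n} S ∣S∣<n = Fin.¬∀⟶∃¬ n (_∈ S) (_∈? S) λ all →
  ℕ.<⇒≱ ∣S∣<n (injectiveInto⇒≤∣∣ S id all id)

x∉S-x : ∀ (S : Subset n) → x ∉ S - x
x∉S-x {x = zero}  (_ ∷ S) ()
x∉S-x {x = suc x} (_ ∷ S) (there x∈) = x∉S-x S x∈

-- Colourings of induced subgraphs

-- Colouring total functions, with arbitrary values outside S, avoids membership proofs.
IsColouring : Graph (Fin n) → Subset n → (Fin n → Fin j) → Set
IsColouring G S f = ∀ {u v} → u ∈ S → v ∈ S → f u ≡ f v → ¬ Adj G u v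

ColourableOn : Graph (Fin n) → ℕ → Subset n → Set
ColourableOn {n} G j S = ∃ λ (f : Fin n → Fin j) → IsColouring G S f

module _ (G : Graph (Fin n)) where

  induced⇒colourableOn : Colourable (G [ S ]) (suc j) → ColourableOn G (suc j) S
  induced⇒colourableOn {S} {j} (colour , proper) = f , isColouring
    where
    f : Fin n → Fin (suc j)
    f v with v ∈? S
    ... | yes v∈S = colour (v , v∈S)
    -- An arbitrary value outside `S`; it exists because the number of colours is a successor.
    ... | no  _   = zero
    isColouring : IsColouring G S f
    isColouring {u} {v} u∈S v∈S fu≡fv u~v with u ∈? S | v ∈? S
    ... | yes _ | yes _  = proper _ _ u~v fu≡fv
    ... | no u∉S | _     = u∉S u∈S
    ... | yes _ | no v∉S = v∉S v∈S

  colourableOn⇒induced : ColourableOn G j S → Colourable (G [ S ]) j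
  colourableOn⇒induced (f , isColouring) =
    f ∘ proj₁ , λ { (_ , u∈S) (_ , v∈S) u~v fu≡fv → isColouring u∈S v∈S fu≡fv u~v }

  restrict : ∀ {T} → S ⊆ T → ColourableOn G j T → ColourableOn G j S
  restrict S⊆T (f , isColouring) = f , λ u∈S v∈S → isColouring (S⊆T u∈S) (S⊆T v∈S)

  isColouring? : ∀ S (f : Fin n → Fin j) → Dec (IsColouring G S f)
  isColouring? S f = map′ (λ h {u} {v} → h u v) (λ h u v → h {u} {v})
    (all? λ u → all? λ v → (u ∈? S) →-dec (v ∈? S) →-dec (f u Fin.≟ f v) →-dec ¬? (adj? G u v))

  -- Colourings are coded in a finite set by `funToFin`, so the search is finite. It lets `extend`
  -- exhibit a vertex instead of merely refuting maximality.
  colourableOn? : ∀ j S → Dec (ColourableOn G j S)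
  colourableOn? j S = map′ {A = ∃ λ i → IsColouring G S (finToFun i)}
    (λ (i , isColouring) → finToFun i , isColouring)
    (λ (f , isColouring) → funToFin f , λ u∈S v∈S eq → isColouring u∈S v∈S
      (trans (sym (Fin.finToFun-funToFin f _)) (trans eq (Fin.finToFun-funToFin f _))))
    (any? λ i → isColouring? S (finToFun i))

  -- w may already lie in S, in which case it is recoloured.
  insertInto : ∀ {f : Fin n → Fin j} {i} → IsColouring G S f →
    (∀ {u} → u ∈ S → u ≢ w → f u ≡ i → ¬ Adj G w u) →
    IsColouring G (S ∪ ⁅ w ⁆) (updateAt f w (const i))
  insertInto {S = S} {w = w} {f = f} {i} isColouring free {u} {v} u∈ v∈ eq u~v
    with u Fin.≟ w | v Fin.≟ w
  ... | yes refl | yes refl = Graph.irrefl G refl u~v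
  ... | no u≢w | no v≢w with ∈-insert⁻ u∈ | ∈-insert⁻ v∈
  ... | inj₂ u≡w | _        = u≢w u≡w
  ... | inj₁ _   | inj₂ v≡w = v≢w v≡w
  ... | inj₁ u∈S | inj₁ v∈S = isColouring u∈S v∈S
    (trans (sym (updateAt-minimal u w f u≢w)) (trans eq (updateAt-minimal v w f v≢w))) u~v
  insertInto {S = S} {w = w} {f = f} {i} isColouring free {u} {v} u∈ v∈ eq u~v
    | yes refl | no v≢w with ∈-insert⁻ v∈
  ... | inj₂ v≡w = v≢w v≡w
  ... | inj₁ v∈S = free v∈S v≢w
    (trans (sym (updateAt-minimal v w f v≢w)) (trans (sym eq) (updateAt-updates w f))) u~v
  insertInto {S = S} {w = w} {f = f} {i} isColouring free {u} {v} u∈ v∈ eq u~v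
    | no u≢w | yes refl with ∈-insert⁻ u∈
  ... | inj₂ u≡w = u≢w u≡w
  ... | inj₁ u∈S = free u∈S u≢w
    (trans (sym (updateAt-minimal u w f u≢w)) (trans eq (updateAt-updates w f)))
    (Graph.symmetric G u~v)

-- Colour classes with at most two vertices

NoIndependentTriple : Graph (Fin n) → Set
NoIndependentTriple G = ∀ {u v w} → u ≢ v → u ≢ w → v ≢ w →
  ¬ Adj G u v → ¬ Adj G u w → Adj G v w

module Rank {G : Graph (Fin n)} (noTriple : NoIndependentTriple G)
            {S : Subset n} {f : Fin n → Fin j} (isColouring : IsColouring G S f) where

  classSize≤2 : u ∈ S → v ∈ S → w ∈ S → f u ≡ f v → f u ≡ f w → u ≢ v → u ≢ w → v ≡ w
  classSize≤2 {u} {v} {w} u∈S v∈S w∈S fu≡fv fu≡fw u≢v u≢w with v Fin.≟ w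
  ... | yes v≡w = v≡w
  ... | no v≢w = contradiction
    (noTriple u≢v u≢w v≢w (isColouring u∈S v∈S fu≡fv) (isColouring u∈S w∈S fu≡fw))
    (isColouring v∈S w∈S (trans (sym fu≡fv) fu≡fw))

  predecessor? : ∀ v → Dec (∃ λ u → u Fin.< v × u ∈ S × f u ≡ f v)
  predecessor? v = any? λ u → (u Fin.<? v) ×-dec (u ∈? S) ×-dec (f u Fin.≟ f v)

  -- Numbers the at most two members of a class in `S` by their order in `Fin n`, so that colour and
  -- rank together identify a vertex of `S`.
  rank : Fin n → Fin 2
  rank v with predecessor? v
  ... | yes _ = suc zero
  ... | no  _ = zero

  -- A predecessor `t` of `u` would make `t`, `u`, `v` three vertices of one class, so only `v` has
  -- a predecessor.
  rank≢ : u ∈ S → v ∈ S → f u ≡ f v → u Fin.< v → rank u ≢ rank v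
  rank≢ {u} {v} u∈S v∈S fu≡fv u<v eq with predecessor? u | predecessor? v
  rank≢ {u} {v} u∈S v∈S fu≡fv u<v _ | _ | no none = none (u , u<v , u∈S , fu≡fv)
  rank≢ {u} {v} u∈S v∈S fu≡fv u<v () | no _ | yes _
  rank≢ {u} {v} u∈S v∈S fu≡fv u<v _ | yes (t , t<u , t∈S , ft≡fu) | yes _ =
    Fin.<⇒≢ u<v (classSize≤2 t∈S u∈S v∈S ft≡fu (trans ft≡fu fu≡fv)
      (Fin.<⇒≢ t<u) (Fin.<⇒≢ (Fin.<-trans t<u u<v)))

  label : Fin n → Fin (j * 2)
  label v = combine (f v) (rank v)

  label-injective : u ∈ S → v ∈ S → label u ≡ label v → u ≡ v
  label-injective {u} {v} u∈S v∈S eq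
    with fu≡fv , ru≡rv ← Fin.combine-injective (f u) (rank u) (f v) (rank v) eq
    with Fin.<-cmp u v
  ... | tri≈ _ u≡v _ = u≡v
  ... | tri< u<v _ _ = contradiction ru≡rv (rank≢ u∈S v∈S fu≡fv u<v)
  ... | tri> _ _ v<u = contradiction (sym ru≡rv) (rank≢ v∈S u∈S (sym fu≡fv) v<u)

  ∣S∣≤j*2 : ∣ S ∣ ≤ j * 2
  ∣S∣≤j*2 = injectiveOn⇒∣∣≤ S label label-injective

  module _ (∣S∣≡j*2 : ∣ S ∣ ≡ j * 2) where

    label-surjective : ∀ i → ∃ λ v → v ∈ S × label v ≡ i
    label-surjective = injectiveOn⇒surjective S label label-injective ∣S∣≡j*2

    -- With 2j vertices every label is taken, in particular the one with the colour of `v` and the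
    -- opposite rank.
    classmate : v ∈ S → ∃ λ u → u ∈ S × u ≢ v × f u ≡ f v
    classmate {v} v∈S =
      let u , u∈S , eq = label-surjective (combine (f v) (opposite (rank v)))
          fu≡fv , ru≡ = Fin.combine-injective (f u) (rank u) (f v) _ eq
      in u , u∈S , (λ u≡v → opposite-≢ (rank v) (trans (sym ru≡) (cong rank u≡v))) , fu≡fv

-- Exchanging colours along a near-perfect matching of the complement

Extendable : Graph (Fin n) → ℕ → Subset n → Set
Extendable G j S = ∃ λ w → w ∉ S × ColourableOn G j (S ∪ ⁅ w ⁆)

-- A perfect matching of the complement of G minus x; x is its own partner.
record NearPerfectMatching (G : Graph (Fin n)) (x : Fin n) : Set where
  field
    partner    : Fin n → Fin n
    involutive : ∀ v → partner (partner v) ≡ v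
    missed     : partner x ≡ x
    fixed      : partner v ≡ v → v ≡ x
    nonadj     : ∀ v → ¬ Adj G v (partner v)

module _ {G : Graph (Fin n)} {x y : Fin n} (P : NearPerfectMatching G x)
         (x≢y : x ≢ y) (x≁y : ¬ Adj G x y) where
  open NearPerfectMatching P

  private
    swapped : Fin n → Fin n
    swapped v with v Fin.≟ x | v Fin.≟ y | v Fin.≟ partner y
    ... | yes _ | _     | _     = y
    ... | no _  | yes _ | _     = x
    ... | no _  | no _  | yes _ = v
    ... | no _  | no _  | no _  = partner v

    x≢z : x ≢ partner y
    x≢z x≡z = x≢y (trans (sym missed) (trans (cong partner x≡z) (involutive y)))

    y≢z : y ≢ partner y
    y≢z y≡z = x≢y (sym (fixed (sym y≡z)))

    swapped-x : swapped x ≡ y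
    swapped-x with x Fin.≟ x
    ... | yes _ = refl
    ... | no x≢x = contradiction refl x≢x

    swapped-y : swapped y ≡ x
    swapped-y with y Fin.≟ x | y Fin.≟ y
    ... | yes y≡x | _ = y≡x
    ... | no _ | yes _ = refl
    ... | no _ | no y≢y = contradiction refl y≢y

    swapped-z : swapped (partner y) ≡ partner y
    swapped-z with partner y Fin.≟ x | partner y Fin.≟ y | partner y Fin.≟ partner y
    ... | yes z≡x | _ | _ = contradiction (sym z≡x) x≢z
    ... | no _ | yes z≡y | _ = contradiction (sym z≡y) y≢z
    ... | no _ | no _ | yes _ = refl
    ... | no _ | no _ | no z≢z = contradiction refl z≢z

  swapped-other : v ≢ x → v ≢ y → v ≢ partner y → swapped v ≡ partner v
  swapped-other {v} v≢x v≢y v≢z with v Fin.≟ x | v Fin.≟ y | v Fin.≟ partner y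
  ... | yes v≡x | _ | _ = contradiction v≡x v≢x
  ... | no _ | yes v≡y | _ = contradiction v≡y v≢y
  ... | no _ | no _ | yes v≡z = contradiction v≡z v≢z
  ... | no _ | no _ | no _ = refl

  private
    data View : Fin n → Set where
      is-x  : View x
      is-y  : View y
      is-z  : View (partner y)
      other : v ≢ x → v ≢ y → v ≢ partner y → View v

    view : ∀ v → View v
    view v with v Fin.≟ x | v Fin.≟ y | v Fin.≟ partner y
    ... | yes refl | _ | _ = is-x
    ... | no _ | yes refl | _ = is-y
    ... | no _ | no _ | yes refl = is-z
    ... | no v≢x | no v≢y | no v≢z = other v≢x v≢y v≢z

    partner≢ : ∀ {u} → v ≢ partner u → partner v ≢ u
    partner≢ v≢pu pv≡u = v≢pu (trans (sym (involutive _)) (cong partner pv≡u))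

  -- The edge from `x` to `y` replaces the edge from `y` to its partner, which becomes the missed
  -- vertex. This is one step of two edges along an alternating path.
  swap : NearPerfectMatching G (partner y)
  swap = record
    { partner    = swapped
    ; involutive = λ v → swapped-involutive (view v)
    ; missed     = swapped-z
    ; fixed      = λ {v} → swapped-fixed (view v)
    ; nonadj     = λ v → swapped-nonadj (view v)
    }
    where
    swapped-involutive : View v → swapped (swapped v) ≡ v
    swapped-involutive is-x = trans (cong swapped swapped-x) swapped-y
    swapped-involutive is-y = trans (cong swapped swapped-y) swapped-x
    swapped-involutive is-z = trans (cong swapped swapped-z) swapped-z
    swapped-involutive (other v≢x v≢y v≢z) = trans
      (cong swapped (swapped-other v≢x v≢y v≢z))
      (trans (swapped-other
        (partner≢ λ v≡px → v≢x (trans v≡px missed))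
        (partner≢ v≢z)
        (partner≢ λ v≡ppy → v≢y (trans v≡ppy (involutive _))))
        (involutive _))

    swapped-fixed : View v → swapped v ≡ v → v ≡ partner y
    swapped-fixed is-x eq = contradiction (trans (sym eq) swapped-x) x≢y
    swapped-fixed is-y eq = contradiction (trans (sym swapped-y) eq) x≢y
    swapped-fixed is-z _  = refl
    swapped-fixed (other v≢x v≢y v≢z) eq =
      contradiction (fixed (trans (sym (swapped-other v≢x v≢y v≢z)) eq)) v≢x

    swapped-nonadj : View v → ¬ Adj G v (swapped v)
    swapped-nonadj is-x = x≁y ∘ subst (Adj G x) swapped-x
    swapped-nonadj is-y = x≁y ∘ Graph.symmetric G ∘ subst (Adj G y) swapped-y
    swapped-nonadj is-z = Graph.irrefl G (sym swapped-z)
    swapped-nonadj (other v≢x v≢y v≢z) =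
      nonadj _ ∘ subst (Adj G _) (swapped-other v≢x v≢y v≢z)

Alone : Subset n → (Fin n → Fin j) → Fin n → Set
Alone S f v = v ∈ S × (∀ {u} → u ∈ S → f u ≡ f v → u ≡ v)

module _ {G : Graph (Fin n)} (noTriple : NoIndependentTriple G)
         {S : Subset n} (P : NearPerfectMatching G x) (w∉S : w ∉ S) (x≁w : ¬ Adj G x w) where
  open NearPerfectMatching P

  -- If y is the partner of the lone vertex v, recolouring y like v leaves y's former
  -- classmate alone. This walks along the symmetric difference of P and the colour
  -- classes; A collects the vertices at which the two already agree.
  exchange : ∀ {f : Fin n → Fin j} {v} (A : Subset n) → Acc _⊃_ A →
    (∀ {u} → u ∈ A → partner u ∈ S × f u ≡ f (partner u)) →
    IsColouring G S f → Alone S f v → Extendable G j S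
  exchange {j = j} {f} {v} A (acc rec) agree isColouring (v∈S , alone) with v Fin.≟ x
  -- The lone vertex is now the missed vertex `x`, which is not adjacent to `w`, so its class has
  -- room for `w`.
  ... | yes refl = w , w∉S , _ ,
        insertInto G {w = w} {i = f v} isColouring
          (λ u∈S _ fu≡fv w~u → x≁w (Graph.symmetric G (subst (Adj G w) (alone u∈S fu≡fv) w~u)))
  ... | no v≢x with partner v ∈? S
  ... | no y∉S = partner v , y∉S , _ , insertInto G {i = f v} isColouring
          (λ u∈S _ fu≡fv y~u → nonadj v (Graph.symmetric G
            (subst (Adj G (partner v)) (alone u∈S fu≡fv) y~u)))
  ... | yes y∈S = cont
    where
    y = partner v

    y≢v : y ≢ v
    y≢v = v≢x ∘ fixed

    fy≢fv : f y ≢ f v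
    fy≢fv = y≢v ∘ alone y∈S

    f′ : Fin n → Fin j
    f′ = updateAt f y (const (f v))

    f′y : f′ y ≡ f v
    f′y = updateAt-updates y f

    f′-other : ∀ {u} → u ≢ y → f′ u ≡ f u
    f′-other = updateAt-minimal _ y f

    isColouring′ : IsColouring G S f′
    isColouring′ u∈S v∈S = insertInto G {w = y} isColouring
      (λ u∈S _ fu≡fv y~u → nonadj v (Graph.symmetric G
        (subst (Adj G y) (alone u∈S fu≡fv) y~u)))
      (∈-insertˡ u∈S) (∈-insertˡ v∈S)

    cont : Extendable G j S
    cont with any? (λ z → (z ∈? S) ×-dec ¬? (z Fin.≟ y) ×-dec (f z Fin.≟ f y))
    -- Moving `y` to the class of `v` has emptied the class of colour `f y`, so `w` may take that
    -- colour.
    ... | no none = w , w∉S , _ , insertInto G {i = f y} isColouring′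
            λ {u} u∈S _ f′u≡fy _ → unused u∈S f′u≡fy
      where
      unused : ∀ {u} → u ∈ S → f′ u ≢ f y
      unused {u} u∈S f′u≡fy with u Fin.≟ y
      ... | yes refl = fy≢fv (trans (sym f′u≡fy) f′y)
      ... | no u≢y = none (u , u∈S , u≢y , trans (sym (f′-other u≢y)) f′u≡fy)
    ... | yes (z , z∈S , z≢y , fz≡fy) =
      exchange (A ∪ ⁅ v ⁆) (rec (⊂-insert v∉A)) agree′ isColouring′ (z∈S , alone′)
      where
      -- A vertex of `A` shares its colour with its partner, whereas `v` and `y` differ in colour.
      -- Hence `A` grows strictly and the walk ends.
      v∉A : v ∉ A
      v∉A v∈A = fy≢fv (sym (proj₂ (agree v∈A)))

      agree′ : ∀ {u} → u ∈ A ∪ ⁅ v ⁆ → partner u ∈ S × f′ u ≡ f′ (partner u)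
      agree′ {u} u∈ with ∈-insert⁻ u∈
      ... | inj₂ refl = y∈S , trans (f′-other (≢-sym y≢v)) (sym f′y)
      -- Neither `y` nor its partner `v` is in `A`, so recolouring `y` keeps every earlier
      -- agreement.
      ... | inj₁ u∈A = proj₁ (agree u∈A) ,
        trans (f′-other u≢y) (trans (proj₂ (agree u∈A)) (sym (f′-other pu≢y)))
        where
        u≢y : u ≢ y
        u≢y refl = fy≢fv (trans (proj₂ (agree u∈A)) (cong f (involutive v)))
        pu≢y : partner u ≢ y
        pu≢y pu≡y = v∉A (subst (_∈ A)
          (trans (sym (involutive u)) (trans (cong partner pu≡y) (involutive v))) u∈A)

      -- Before the recolouring `y` and `z` filled a class of two, so `z` loses its only classmate.
      alone′ : ∀ {u} → u ∈ S → f′ u ≡ f′ z → u ≡ z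
      alone′ {u} u∈S f′u≡f′z with u Fin.≟ y
      ... | yes refl = contradiction
        (trans (sym fz≡fy) (trans (sym (f′-other z≢y)) (trans (sym f′u≡f′z) f′y))) fy≢fv
      ... | no u≢y = Rank.classSize≤2 {G = G} noTriple isColouring y∈S u∈S z∈S
        (sym (trans (sym (f′-other u≢y)) (trans f′u≡f′z (trans (f′-other z≢y) fz≡fy))))
        (sym fz≡fy) (≢-sym u≢y) (≢-sym z≢y)

module _ {G : Graph (Fin n)} (noTriple : NoIndependentTriple G) where

  -- Some colour class has at most one vertex, since fewer than 2j vertices are coloured.
  small⇒extendable :
    (∀ w → ∃ λ x → NearPerfectMatching G x × ¬ Adj G x w) →
    ∣ S ∣ < j * 2 → ∣ S ∣ < n → ColourableOn G j S → Extendable G j S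
  small⇒extendable {S} {j} near ∣S∣<j*2 ∣S∣<n (f , isColouring) = found
    where
    HasTwo : Fin j → Set
    HasTwo i = ∃ λ u → ∃ λ v → u ∈ S × v ∈ S × u ≢ v × f u ≡ i × f v ≡ i

    hasTwo? : ∀ i → Dec (HasTwo i)
    hasTwo? i = any? λ u → any? λ v → (u ∈? S) ×-dec (v ∈? S) ×-dec ¬? (u Fin.≟ v)
      ×-dec (f u Fin.≟ i) ×-dec (f v Fin.≟ i)

    ¬allTwo : ¬ (∀ i → HasTwo i)
    ¬allTwo two = ℕ.<⇒≱ ∣S∣<j*2 (injectiveInto⇒≤∣∣ S g g∈S g-injective)
      where
      pick : Fin j → Fin 2 → Fin n
      pick i zero       = proj₁ (two i)
      pick i (suc zero) = proj₁ (proj₂ (two i))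

      pick∈S : ∀ i r → pick i r ∈ S
      pick∈S i zero       = let _ , _ , u∈S , _ = two i in u∈S
      pick∈S i (suc zero) = let _ , _ , _ , v∈S , _ = two i in v∈S

      f-pick : ∀ i r → f (pick i r) ≡ i
      f-pick i zero       = let _ , _ , _ , _ , _ , fu , _ = two i in fu
      f-pick i (suc zero) = let _ , _ , _ , _ , _ , _ , fv = two i in fv

      pick-injective : ∀ i r s → pick i r ≡ pick i s → r ≡ s
      pick-injective i zero       zero       _  = refl
      pick-injective i (suc zero) (suc zero) _  = refl
      pick-injective i zero       (suc zero) eq =
        let _ , _ , _ , _ , u≢v , _ = two i in contradiction eq u≢v
      pick-injective i (suc zero) zero       eq =
        let _ , _ , _ , _ , u≢v , _ = two i in contradiction (sym eq) u≢v

      g : Fin (j * 2) → Fin n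
      g i = pick (quotient 2 i) (remainder {j} 2 i)

      g∈S : ∀ i → g i ∈ S
      g∈S i = pick∈S _ (remainder {j} 2 i)

      g-injective : Injective _≡_ _≡_ g
      g-injective {a} {b} eq = trans (sym (Fin.combine-remQuot {j} 2 a))
        (trans (cong₂ combine q≡q
          (pick-injective _ _ _ (trans eq (cong (λ i → pick i (remainder {j} 2 b)) (sym q≡q)))))
          (Fin.combine-remQuot {j} 2 b))
        where
        q≡q : quotient {j} 2 a ≡ quotient 2 b
        q≡q = trans (sym (f-pick _ (remainder {j} 2 a)))
          (trans (cong f eq) (f-pick _ (remainder {j} 2 b)))

    found : Extendable G j S
    found with ∣S∣<n⇒∃∉ S ∣S∣<n | Fin.¬∀⟶∃¬ j HasTwo hasTwo? ¬allTwo
    ... | w , w∉S | i , ¬two with any? (λ v → (v ∈? S) ×-dec (f v Fin.≟ i))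
    ... | no none = w , w∉S , _ , insertInto G {i = i} isColouring
            λ {u} u∈S _ fu≡i _ → none (u , u∈S , fu≡i)
    -- Colour `i` occurs in `S` but not twice, so `v` is alone in its class and the exchange can
    -- begin.
    ... | yes (v , v∈S , fv≡i) with near w
    ... | x , P , x≁w = exchange noTriple P w∉S x≁w ⊥ (⊃-wellFounded ⊥)
            (λ u∈⊥ → contradiction u∈⊥ ∉⊥) isColouring (v∈S , alone)
      where
      alone : ∀ {u} → u ∈ S → f u ≡ f v → u ≡ v
      alone {u} u∈S fu≡fv with u Fin.≟ v
      ... | yes u≡v = u≡v
      ... | no u≢v = contradiction (u , v , u∈S , v∈S , u≢v , trans fu≡fv fv≡i , fv≡i) ¬two

-- Entries of the sequence, mates and independent triples

lookup-applyUpTo-∷ʳ : ∀ {A : Set} (f : ℕ → A) k b (i : Fin (length (applyUpTo f k ∷ʳ b))) →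
  (toℕ i < k × lookup (applyUpTo f k ∷ʳ b) i ≡ f (toℕ i)) ⊎
  (toℕ i ≡ k × lookup (applyUpTo f k ∷ʳ b) i ≡ b)
lookup-applyUpTo-∷ʳ f 0       b zero    = inj₂ (refl , refl)
lookup-applyUpTo-∷ʳ f (suc k) b zero    = inj₁ (s≤s z≤n , refl)
lookup-applyUpTo-∷ʳ f (suc k) b (suc i) =
  Sum.map (λ (i<k , eq) → s≤s i<k , eq) (λ (i≡k , eq) → cong suc i≡k , eq)
    (lookup-applyUpTo-∷ʳ (f ∘ suc) k b i)

length-applyUpTo-∷ʳ : ∀ {A : Set} (f : ℕ → A) k b → length (applyUpTo f k ∷ʳ b) ≡ suc k
length-applyUpTo-∷ʳ f k b = trans (length-++ (applyUpTo f k))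
  (trans (cong (_+ 1) (length-applyUpTo f k)) (ℕ.+-comm k 1))

∃∈-≡ : {a b : ∃ λ v → v ∈ S} → proj₁ a ≡ proj₁ b → a ≡ b
∃∈-≡ {a = v , p} {b = .v , q} refl = cong (v ,_) ([]=-irrelevant p q)

mate-involutive : ∀ k v → mate k (mate k v) ≡ v
mate-involutive k v = mate-unique k (mate k v) (≢-sym (mate-≢ k v)) (quotient-mate k v)

∣triple∣ : u ≢ v → u ≢ w → v ≢ w → ∣ (⁅ u ⁆ ∪ ⁅ v ⁆) ∪ ⁅ w ⁆ ∣ ≡ 3
∣triple∣ {u = u} {v} {w} u≢v u≢w v≢w = begin
  ∣ (⁅ u ⁆ ∪ ⁅ v ⁆) ∪ ⁅ w ⁆ ∣  ≡⟨ ∣insert∣ (⁅ u ⁆ ∪ ⁅ v ⁆) w∉ ⟩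
  suc ∣ ⁅ u ⁆ ∪ ⁅ v ⁆ ∣        ≡⟨ cong suc (∣insert∣ ⁅ u ⁆ (u≢v ∘ sym ∘ x∈⁅y⁆⇒x≡y u)) ⟩
  2 + ∣ ⁅ u ⁆ ∣                ≡⟨ cong (2 +_) (∣⁅x⁆∣≡1 u) ⟩
  3                            ∎
  where
  open ≡-Reasoning
  w∉ : w ∉ ⁅ u ⁆ ∪ ⁅ v ⁆
  w∉ w∈ with ∈-insert⁻ w∈
  ... | inj₁ w∈u = u≢w (sym (x∈⁅y⁆⇒x≡y u w∈u))
  ... | inj₂ w≡v = v≢w (sym w≡v)

independentTriple : (G : Graph (Fin n)) → ¬ Adj G u v → ¬ Adj G u w → ¬ Adj G v w →
  Independent G (_∈ (⁅ u ⁆ ∪ ⁅ v ⁆) ∪ ⁅ w ⁆)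
independentTriple {u = u} {v} {w} G u≁v u≁w v≁w s t s∈ t∈ s~t with cases s∈ | cases t∈
  where
  cases : ∀ {t} → t ∈ (⁅ u ⁆ ∪ ⁅ v ⁆) ∪ ⁅ w ⁆ → t ≡ u ⊎ t ≡ v ⊎ t ≡ w
  cases t∈ with ∈-insert⁻ t∈
  ... | inj₂ t≡w = inj₂ (inj₂ t≡w)
  ... | inj₁ t∈uv with ∈-insert⁻ t∈uv
  ... | inj₂ t≡v = inj₂ (inj₁ t≡v)
  ... | inj₁ t∈u = inj₁ (x∈⁅y⁆⇒x≡y u t∈u)
... | inj₁ refl        | inj₁ refl        = Graph.irrefl G refl s~t
... | inj₁ refl        | inj₂ (inj₁ refl) = u≁v s~t
... | inj₁ refl        | inj₂ (inj₂ refl) = u≁w s~t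
... | inj₂ (inj₁ refl) | inj₁ refl        = u≁v (Graph.symmetric G s~t)
... | inj₂ (inj₁ refl) | inj₂ (inj₁ refl) = Graph.irrefl G refl s~t
... | inj₂ (inj₁ refl) | inj₂ (inj₂ refl) = v≁w s~t
... | inj₂ (inj₂ refl) | inj₁ refl        = u≁w (Graph.symmetric G s~t)
... | inj₂ (inj₂ refl) | inj₂ (inj₁ refl) = v≁w (Graph.symmetric G s~t)
... | inj₂ (inj₂ refl) | inj₂ (inj₂ refl) = Graph.irrefl G refl s~t

-- From the construction to the sequence

module FromConstruction {k : ℕ} {G : Graph (Fin n)} (F : FormedByConstruction k G) where
  open FormedByConstruction F using (c; G₁; G₁≅G-c; spanning; α[G₁]≡2; M; independent; dominating)
  open _≅_ G₁≅G-c using (bijection; preserves) renaming (to to toG; from to fromG)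

  e : Fin (k * 2) → Fin n
  e u = proj₁ (toG u)

  e-injective : Injective _≡_ _≡_ e
  e-injective {u} {v} eq = trans (sym (Inverse.strictlyInverseʳ bijection u))
    (trans (cong fromG (∃∈-≡ eq)) (Inverse.strictlyInverseʳ bijection v))

  e≢c : ∀ u → e u ≢ c
  e≢c u eq = x∉S-x ⊤ (subst (_∈ ⊤ - c) eq (proj₂ (toG u)))

  vertex : ∀ v → v ≡ c ⊎ ∃ λ u → e u ≡ v
  vertex v with v Fin.≟ c
  ... | yes v≡c = inj₁ v≡c
  ... | no v≢c  = inj₂ (fromG (v , x∈p∧x≢y⇒x∈p-y ∈⊤ v≢c) ,
                        cong proj₁ (Inverse.strictlyInverseˡ bijection _))

  e-adj : ∀ {u v} → Adj G₁ u v → Adj G (e u) (e v)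
  e-adj = Equivalence.to (preserves _ _)

  e-adj⁻ : ∀ {u v} → Adj G (e u) (e v) → Adj G₁ u v
  e-adj⁻ = Equivalence.from (preserves _ _)

  index : Fin n → Fin (suc (k * 2))
  index v with vertex v
  ... | inj₁ _       = zero
  ... | inj₂ (u , _) = suc u

  index-injective : Injective _≡_ _≡_ index
  index-injective {v} {w} eq with vertex v | vertex w
  ... | inj₁ refl       | inj₁ refl       = refl
  ... | inj₂ (_ , refl) | inj₂ (_ , refl) = cong e (Fin.suc-injective eq)
  index-injective () | inj₁ _ | inj₂ _
  index-injective () | inj₂ _ | inj₁ _

  order : n ≡ suc (k * 2)
  order = Fin.cantor-schröder-bernstein index-injective include-injective
    where
    include : Fin (suc (k * 2)) → Fin n
    include zero    = c
    include (suc u) = e u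

    include-injective : Injective _≡_ _≡_ include
    include-injective {zero}  {zero}  _  = refl
    include-injective {zero}  {suc v} eq = contradiction (sym eq) (e≢c v)
    include-injective {suc u} {zero}  eq = contradiction eq (e≢c u)
    include-injective {suc u} {suc v} eq = cong suc (e-injective eq)

  noTriple₁ : NoIndependentTriple G₁
  noTriple₁ {u} {v} {w} u≢v u≢w v≢w u≁v u≁w with adj? G₁ v w
  ... | yes v~w = v~w
  ... | no v≁w = contradiction
    (subst (_≤ 2) (∣triple∣ u≢v u≢w v≢w)
      (IsIndependenceNumber.maximum α[G₁]≡2 _ (independentTriple G₁ u≁v u≁w v≁w)))
    λ { (s≤s (s≤s ())) }

  -- The non-neighbours of `c` are independent in the complement of `G₁`, hence form a clique. This
  -- is why no independent triple of `G` contains `c`.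
  nonneighbours-adjacent : ∀ {u v} → u ≢ v → ¬ Adj G c (e u) → ¬ Adj G c (e v) → Adj G₁ u v
  nonneighbours-adjacent {u} {v} u≢v c≁u c≁v with adj? G₁ u v
  ... | yes u~v = u~v
  ... | no u≁v = contradiction (u≢v , u≁v) (independent u v
    (λ { (inj₁ eq) → e≢c u eq ; (inj₂ c~u) → c≁u c~u })
    (λ { (inj₁ eq) → e≢c v eq ; (inj₂ c~v) → c≁v c~v }))

  noTriple : NoIndependentTriple G
  noTriple {u} {v} {w} u≢v u≢w v≢w u≁v u≁w with vertex u | vertex v | vertex w
  ... | inj₁ refl | inj₁ refl | _ = contradiction refl u≢v
  ... | inj₁ refl | _ | inj₁ refl = contradiction refl u≢w
  ... | _ | inj₁ refl | inj₁ refl = contradiction refl v≢w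
  ... | inj₁ refl | inj₂ (_ , refl) | inj₂ (_ , refl) =
        e-adj (nonneighbours-adjacent (v≢w ∘ cong e) u≁v u≁w)
  ... | inj₂ (_ , refl) | inj₂ (_ , refl) | inj₂ (_ , refl) =
        e-adj (noTriple₁ (u≢v ∘ cong e) (u≢w ∘ cong e) (v≢w ∘ cong e)
          (u≁v ∘ e-adj) (u≁w ∘ e-adj))
  ... | inj₂ (_ , refl) | inj₁ refl | inj₂ (w′ , refl) with adj? G c (e w′)
  ... | yes v~w = v~w
  ... | no v≁w = contradiction (e-adj (nonneighbours-adjacent (u≢w ∘ cong e)
        (u≁v ∘ Graph.symmetric G) v≁w)) u≁w
  noTriple {u} {v} {w} u≢v u≢w v≢w u≁v u≁w
    | inj₂ (_ , refl) | inj₂ (v′ , refl) | inj₁ refl with adj? G (e v′) c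
  ... | yes v~w = v~w
  ... | no v≁w = contradiction (e-adj (nonneighbours-adjacent (u≢v ∘ cong e)
        (u≁w ∘ Graph.symmetric G) (v≁w ∘ Graph.symmetric G))) u≁v

  colouring : Colourable G (suc k)
  colouring = colour , λ u v u~v → proper u v u~v
    where
    colour : Fin n → Fin (suc k)
    colour v with vertex v
    ... | inj₁ _       = zero
    ... | inj₂ (u , _) = suc (quotient 2 u)

    proper : ∀ u v → Adj G u v → colour u ≢ colour v
    proper u v u~v eq with vertex u | vertex v
    ... | inj₁ refl       | inj₁ refl       = Graph.irrefl G refl u~v
    ... | inj₂ (_ , refl) | inj₂ (_ , refl) = spanning (e-adj⁻ u~v) (Fin.suc-injective eq)
    proper u v u~v () | inj₁ _ | inj₂ _
    proper u v u~v () | inj₂ _ | inj₁ _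

  -- Moving the missed vertex along alternating paths

  Missable : Fin n → Set
  Missable w = ∃ λ x → NearPerfectMatching G x × ¬ Adj G x w

  -- The matching `M` carried over to `G`. The type keeps the equation for `partner`, since
  -- `followPath` compares partners with mates.
  partiteNearMatching : Σ[ P ∈ NearPerfectMatching G c ]
    (∀ u → NearPerfectMatching.partner P (e u) ≡ e (mate k u))
  partiteNearMatching = record
    { partner    = partner
    ; involutive = involutive
    ; missed     = partner-c
    ; fixed      = fixed _
    ; nonadj     = nonadj
    } , partner-e
    where
    partner : Fin n → Fin n
    partner v with vertex v
    ... | inj₁ _       = c
    ... | inj₂ (u , _) = e (mate k u)

    partner-c : partner c ≡ c
    partner-c with vertex c
    ... | inj₁ _        = refl
    ... | inj₂ (u , eq) = contradiction eq (e≢c u)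

    partner-e : ∀ u → partner (e u) ≡ e (mate k u)
    partner-e u with vertex (e u)
    ... | inj₁ eq       = contradiction eq (e≢c u)
    ... | inj₂ (v , eq) = cong (e ∘ mate k) (e-injective eq)

    involutive : ∀ v → partner (partner v) ≡ v
    involutive v with vertex v
    ... | inj₁ refl       = partner-c
    ... | inj₂ (u , refl) = trans (partner-e _) (cong e (mate-involutive k u))

    fixed : ∀ v → partner v ≡ v → v ≡ c
    fixed v eq with vertex v
    ... | inj₁ v≡c        = v≡c
    ... | inj₂ (u , refl) = contradiction (sym (e-injective eq)) (mate-≢ k u)

    nonadj : ∀ v → ¬ Adj G v (partner v)
    nonadj v v~p with vertex v
    ... | inj₁ refl       = Graph.irrefl G refl v~p
    ... | inj₂ (u , refl) = spanning (e-adj⁻ v~p) (sym (quotient-mate k u))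

  -- `P` itself serves for `y`. Swapping at `y` gives a matching that misses `z`; it serves for `z`
  -- and for the next vertex, which is not adjacent to `z` in `G`, and the induction goes on from
  -- there. The conditions on `x` and on partners say that earlier swaps left the path ahead
  -- undisturbed.
  followPath : ∀ {x y z vs} (P : NearPerfectMatching G x) → let open NearPerfectMatching P in
    ¬ Adj G x (e y) → Matched M y z → IsAlternatingPath (complement G₁) M (y ∷ z ∷ vs) →
    (∀ {u} → u List.∈ y ∷ z ∷ vs → x ≢ e u) →
    (∀ {u} → u List.∈ y ∷ z ∷ vs → partner (e u) ≡ e (mate k u)) →
    ∀ {v} → v List.∈ y ∷ z ∷ vs → Missable (e v)
  followPath P x≁y y-z path x∉ agree (here refl) = _ , P , x≁y
  followPath {x} {y} {z} P x≁y (y≢z , q≡q) ((_ ∷ edges , (y∉ ∷ z∉ ∷ unique)) , alt) x∉ agree (there v∈) =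
    rest edges z∉ unique y∉ alt x∉ agree v∈
    where
    open NearPerfectMatching P using (partner)
    P′ = swap P (x∉ (here refl)) x≁y

    missed≡z : partner (e y) ≡ e z
    missed≡z = trans (agree (here refl)) (cong e (mate-unique k y y≢z q≡q))

    rest : ∀ {vs} → Linked (Adj (complement G₁)) (z ∷ vs) → All (z ≢_) vs → Unique vs →
      All (y ≢_) (z ∷ vs) →
      Alternating (Matched M) (λ u v → Adj (complement G₁) u v × ¬ Matched M u v) (y ∷ z ∷ vs) →
      (∀ {u} → u List.∈ y ∷ z ∷ vs → x ≢ e u) →
      (∀ {u} → u List.∈ y ∷ z ∷ vs → partner (e u) ≡ e (mate k u)) →
      ∀ {v} → v List.∈ z ∷ vs → Missable (e v)
    rest _ _ _ _ _ _ _ (here refl) = _ , P′ , Graph.irrefl G missed≡z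
    rest {y′ ∷ []} ((_ , z≁y′) ∷ _) _ _ _ _ _ _ (there (here refl)) =
      _ , P′ , λ z~y′ → z≁y′ (e-adj⁻ (subst (λ t → Adj G t (e y′)) missed≡z z~y′))
    rest {y′ ∷ z′ ∷ vs} (z-y′@(_ , z≁y′) ∷ edges@((y′≢z′ , y′≁z′) ∷ _)) z∉ unique (_ ∷ y∉)
         (step ¬MM _ (step _ ¬BB alt)) x∉ agree (there v∈) =
      followPath P′ (λ z~y′ → z≁y′ (e-adj⁻ (subst (λ t → Adj G t (e y′)) missed≡z z~y′)))
        (y′≢z′ , q′≡q′) ((edges , unique) , alt)
        (λ u∈ z≡u → All.lookup z∉ u∈ (e-injective (trans (sym missed≡z) z≡u)))
        -- The swap changes partners only at `x`, `y` and `z`, none of which lies on the remaining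
        -- path.
        (λ u∈ → trans
          (swapped-other P (x∉ (here refl)) x≁y
            (λ u≡x → x∉ (there (there u∈)) (sym u≡x))
            (λ u≡y → All.lookup y∉ u∈ (sym (e-injective u≡y)))
            (λ u≡z → All.lookup z∉ u∈ (sym (e-injective (trans u≡z missed≡z)))))
          (agree (there (there u∈))))
        v∈
      where
      -- The edge `y z` is in `M`, so alternation keeps `z y′` out of `M` and puts `y′ z′` back in
      -- it.
      q′≡q′ : quotient {k} 2 y′ ≡ quotient 2 z′
      q′≡q′ with quotient {k} 2 y′ Fin.≟ quotient 2 z′
      ... | yes eq = eq
      ... | no neq = contradiction
        ((z-y′ , λ z-y′∈M → ¬MM ((y≢z , q≡q) , z-y′∈M)) ,
         ((y′≢z′ , y′≁z′) , neq ∘ proj₂)) ¬BB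

  missable : ∀ w → Missable w
  missable w with vertex w
  ... | inj₁ refl = c , proj₁ partiteNearMatching , Graph.irrefl G refl
  ... | inj₂ (v , refl) with dominating v
  ... | inj₁ v∈S = c , proj₁ partiteNearMatching , v∈S ∘ inj₂
  ... | inj₂ (u , w , vs , u∈S , u-w , path , v∈) =
    followPath (proj₁ partiteNearMatching) (u∈S ∘ inj₂) u-w path
      (λ {t} _ c≡t → e≢c t (sym c≡t)) (λ {t} _ → proj₂ partiteNearMatching t) v∈

  -- Up to `k` colours, `Rank` bounds the size from above, and smaller sets are extendable. With
  -- more colours the whole graph is colourable, so no vertex can be left out.
  maximalSize : ∀ {S} → MaximalColourable G (suc j) S →
    (suc j ≤ k × ∣ S ∣ ≡ suc j * 2) ⊎ (k ≤ j × ∣ S ∣ ≡ n)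
  maximalSize {j} {S} max with suc j ℕ.≤? k
  ... | no j≮k = inj₂ (k≤j , full)
    where
    k≤j : k ≤ j
    k≤j = ℕ.≮⇒≥ j≮k

    full : ∣ S ∣ ≡ n
    full with ∣ S ∣ ℕ.<? n
    ... | no ∣S∣≮n = ℕ.≤-antisym (∣p∣≤n S) (ℕ.≮⇒≥ ∣S∣≮n)
    ... | yes ∣S∣<n = let w , w∉S = ∣S∣<n⇒∃∉ S ∣S∣<n in contradiction
      ((λ v → Fin.inject≤ (proj₁ colouring (proj₁ v)) (s≤s k≤j)) ,
        λ u v u~v eq → proj₂ colouring _ _ u~v
          (Fin.inject≤-injective (s≤s k≤j) (s≤s k≤j) _ _ eq))
      (MaximalColourable.maximal max ⊤ (⊆⊤ , w , ∈⊤ , w∉S))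
  ... | yes j<k = inj₁ (j<k , ℕ.≤-antisym
          (Rank.∣S∣≤j*2 {G = G} noTriple {f = f} isColouring) (ℕ.≮⇒≥ ∣S∣≮))
    where
    S-colourable = induced⇒colourableOn G (MaximalColourable.colourable max)
    f = proj₁ S-colourable
    isColouring : IsColouring G S f
    isColouring = proj₂ S-colourable

    ∣S∣≮ : ¬ ∣ S ∣ < suc j * 2
    ∣S∣≮ ∣S∣< =
      let w , w∉S , colourable = small⇒extendable {G = G} noTriple missable ∣S∣<
            (subst (∣ S ∣ <_) (sym order)
              (ℕ.<-≤-trans ∣S∣< (ℕ.≤-trans (ℕ.*-monoˡ-≤ 2 j<k) (ℕ.n≤1+n _))))
            S-colourable
      in MaximalColourable.maximal max _ (⊂-insert w∉S) (colourableOn⇒induced G colourable)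

  wellHuedWithSequence : WellHuedWithSequence G (applyUpTo (λ i → 2 * suc i) k ∷ʳ (2 * k + 1))
  wellHuedWithSequence = record
    { wellHued        = wellHued
    ; chromaticNumber = record
      { colourable = subst (Colourable G) (sym len) colouring
      ; minimum    = λ j colouring → subst (_≤ j) (sym len) (minimum j colouring)
      }
    ; orders          = orders
    }
    where
    len = length-applyUpTo-∷ʳ (λ i → 2 * suc i) k (2 * k + 1)

    wellHued : WellHued G
    wellHued (suc j) _ S T maxS maxT with maximalSize maxS | maximalSize maxT
    ... | inj₁ (_ , ∣S∣≡)   | inj₁ (_ , ∣T∣≡)   = trans ∣S∣≡ (sym ∣T∣≡)
    ... | inj₂ (_ , ∣S∣≡)   | inj₂ (_ , ∣T∣≡)   = trans ∣S∣≡ (sym ∣T∣≡)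
    ... | inj₁ (j<k , _) | inj₂ (k≤j , _) = contradiction k≤j (ℕ.<⇒≱ j<k)
    ... | inj₂ (k≤j , _) | inj₁ (j<k , _) = contradiction k≤j (ℕ.<⇒≱ j<k)

    minimum : ∀ j → Colourable G j → suc k ≤ j
    -- The `j` classes cover at most 2j vertices, and there are 2k+1 to cover.
    minimum j (f , proper) = ℕ.*-cancelʳ-< 2 k j (subst (_≤ j * 2) (trans (∣⊤∣≡n n) order)
      (Rank.∣S∣≤j*2 {G = G} noTriple {S = ⊤} {f = f} λ _ _ eq u~v → proper _ _ u~v eq))

    orders : ∀ i S → MaximalColourable G (suc (toℕ i)) S →
      ∣ S ∣ ≡ lookup (applyUpTo (λ i → 2 * suc i) k ∷ʳ (2 * k + 1)) i
    orders i S max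
      with maximalSize max | lookup-applyUpTo-∷ʳ (λ i → 2 * suc i) k (2 * k + 1) i
    ... | inj₁ (_ , ∣S∣≡) | inj₁ (_ , eq) =
          trans ∣S∣≡ (trans (ℕ.*-comm (suc (toℕ i)) 2) (sym eq))
    ... | inj₂ (_ , ∣S∣≡n) | inj₂ (_ , eq) =
          trans ∣S∣≡n (trans order (trans (cong suc (ℕ.*-comm k 2)) (trans (ℕ.+-comm 1 _) (sym eq))))
    ... | inj₁ (i<k , _) | inj₂ (i≡k , _) = contradiction i≡k (ℕ.<⇒≢ i<k)
    ... | inj₂ (k≤i , _) | inj₁ (i<k , _) = contradiction k≤i (ℕ.<⇒≱ i<k)

-- From the sequence to the construction

module FromSequence {k′ : ℕ} {G : Graph (Fin n)}
  (whs : WellHuedWithSequence G (applyUpTo (λ i → 2 * suc i) (suc k′) ∷ʳ (2 * suc k′ + 1))) where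
  open WellHuedWithSequence whs

  private
    k = suc k′

    length≡ : length (applyUpTo (λ i → 2 * suc i) k ∷ʳ (2 * k + 1)) ≡ suc k
    length≡ = length-applyUpTo-∷ʳ (λ i → 2 * suc i) k (2 * k + 1)

  ∣maximal∣ : ∀ {i S} → i < k → MaximalColourable G (suc i) S → ∣ S ∣ ≡ suc i * 2
  ∣maximal∣ {i} {S} i<k max
    with i<len ← subst (i <_) (sym length≡) (ℕ.m<n⇒m<1+n i<k)
    with eq ← orders (Fin.fromℕ< i<len) S
                (subst (λ j → MaximalColourable G (suc j) S) (sym (Fin.toℕ-fromℕ< i<len)) max)
    with lookup-applyUpTo-∷ʳ (λ i → 2 * suc i) k (2 * k + 1) (Fin.fromℕ< i<len)
  ... | inj₁ (_ , eq′) = trans eq (trans eq′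
          (trans (cong (λ j → 2 * suc j) (Fin.toℕ-fromℕ< i<len)) (ℕ.*-comm 2 (suc i))))
  ... | inj₂ (i≡k , _) = contradiction (trans (sym (Fin.toℕ-fromℕ< i<len)) i≡k) (ℕ.<⇒≢ i<k)

  -- With k+1 colours the whole vertex set is maximal, so the last entry of the sequence counts the
  -- vertices.
  order : n ≡ suc (k * 2)
  order
    with k<len ← subst (k <_) (sym length≡) (ℕ.n<1+n k)
    with eq ← orders (Fin.fromℕ< k<len) ⊤ (subst (λ j → MaximalColourable G j ⊤)
                (trans length≡ (cong suc (sym (Fin.toℕ-fromℕ< k<len))))
                (record
                  { colourable = let f , proper = IsChromaticNumber.colourable chromaticNumber
                                 in f ∘ proj₁ , λ u v → proper (proj₁ u) (proj₁ v)
                  ; maximal    = λ { _ (_ , _ , _ , v∉⊤) → contradiction ∈⊤ v∉⊤ }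
                  }))
    with lookup-applyUpTo-∷ʳ (λ i → 2 * suc i) k (2 * k + 1) (Fin.fromℕ< k<len)
  ... | inj₁ (k<k , _) = contradiction (Fin.toℕ-fromℕ< k<len) (ℕ.<⇒≢ k<k)
  ... | inj₂ (_ , eq′) = trans (sym (∣⊤∣≡n n))
          (trans eq (trans eq′ (trans (ℕ.+-comm (2 * k) 1) (cong suc (ℕ.*-comm 2 k)))))

  -- If no vertex could be added, `S` would be maximal, because a colouring of a larger set
  -- restricts to `S` plus one vertex. But `S` has the wrong size for that.
  extend : ∀ {i} → i < k → ColourableOn G (suc i) S → ∣ S ∣ ≢ suc i * 2 → Extendable G (suc i) S
  extend {S} {i} i<k colourable ∣S∣≢
    with any? (λ w → ¬? (w ∈? S) ×-dec colourableOn? G (suc i) (S ∪ ⁅ w ⁆))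
  ... | yes extendable = extendable
  ... | no stuck = contradiction (∣maximal∣ i<k record
    { colourable = colourableOn⇒induced G colourable
    ; maximal    = λ { S′ (S⊆S′ , w , w∈S′ , w∉S) colourable′ → stuck
        (w , w∉S , restrict G (insert⊆ S⊆S′ w∈S′) (induced⇒colourableOn G colourable′)) }
    }) ∣S∣≢
    where
    insert⊆ : ∀ {w S′} → S ⊆ S′ → w ∈ S′ → S ∪ ⁅ w ⁆ ⊆ S′
    insert⊆ S⊆S′ w∈S′ v∈ with ∈-insert⁻ v∈
    ... | inj₁ v∈S = S⊆S′ v∈S
    ... | inj₂ refl = w∈S′

  -- A colourable set above the bound is never maximal, so it extends, and the extension is again
  -- above the bound. In a finite graph this cannot go on.
  ∣colourable∣≤ : ∀ {i} → i < k → Acc _⊃_ S → ColourableOn G (suc i) S → ∣ S ∣ ≤ suc i * 2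
  ∣colourable∣≤ {S} i<k (acc rec) colourable with ∣ S ∣ ℕ.≤? _
  ... | yes small = small
  ... | no ∣S∣≰ =
    let w , w∉S , colourable′ = extend i<k colourable (∣S∣≰ ∘ ℕ.≤-reflexive)
    in contradiction
      (ℕ.≤-trans (p⊆q⇒∣p∣≤∣q∣ (∈-insertˡ {S = S} {w = w}))
        (∣colourable∣≤ i<k (rec (⊂-insert w∉S)) colourable′))
      ∣S∣≰

  colourableOfSize : ∀ {i} → i < k → ∀ m → m ≤ suc i * 2 →
    ∃ λ S → ∣ S ∣ ≡ m × ColourableOn G (suc i) S
  colourableOfSize i<k 0 _ = ⊥ , ∣⊥∣≡0 n , const zero , λ u∈⊥ → contradiction u∈⊥ ∉⊥
  colourableOfSize i<k (suc m) m<size =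
    let S , ∣S∣≡m , colourable = colourableOfSize i<k m (ℕ.<⇒≤ m<size)
        w , w∉S , colourable′ = extend i<k colourable (ℕ.<⇒≢ m<size ∘ trans (sym ∣S∣≡m))
    in S ∪ ⁅ w ⁆ , trans (∣insert∣ S w∉S) (cong suc ∣S∣≡m) , colourable′

  -- An independent triple would be 1-colourable, with more than two vertices.
  noTriple : NoIndependentTriple G
  noTriple {u} {v} {w} u≢v u≢w v≢w u≁v u≁w with adj? G v w
  ... | yes v~w = v~w
  ... | no v≁w = contradiction
    (subst (_≤ 2) (∣triple∣ u≢v u≢w v≢w) (∣colourable∣≤ (s≤s z≤n) (⊃-wellFounded _)
      (const zero , λ {s} {t} s∈ t∈ _ → independentTriple G u≁v u≁w v≁w s t s∈ t∈)))
    λ { (s≤s (s≤s ())) }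

  -- The vertex `c`, the partite sets and the graph `G₁`

  abstract
    T-spec : ∃ λ T → ∣ T ∣ ≡ k * 2 × ColourableOn G k T
    T-spec = colourableOfSize (ℕ.n<1+n k′) (k * 2) ℕ.≤-refl

  T : Subset n
  T = proj₁ T-spec

  ∣T∣≡ : ∣ T ∣ ≡ k * 2
  ∣T∣≡ = proj₁ (proj₂ T-spec)

  class : Fin n → Fin k
  class = proj₁ (proj₂ (proj₂ T-spec))

  class-isColouring : IsColouring G T class
  class-isColouring = proj₂ (proj₂ (proj₂ T-spec))

  abstract
    label : Fin n → Fin (k * 2)
    label = Rank.label {G = G} noTriple {f = class} class-isColouring

    label-injective : u ∈ T → v ∈ T → label u ≡ label v → u ≡ v
    label-injective = Rank.label-injective {G = G} noTriple {f = class} class-isColouring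

    label-surjective : ∀ i → ∃ λ v → v ∈ T × label v ≡ i
    label-surjective = Rank.label-surjective {G = G} noTriple {f = class} class-isColouring ∣T∣≡

    quotient-label : ∀ v → quotient 2 (label v) ≡ class v
    quotient-label v = cong proj₁ (Fin.remQuot-combine {k} (class v)
      (Rank.rank {G = G} noTriple {f = class} class-isColouring v))

  abstract
    ∃∉T : ∃ λ c → c ∉ T
    ∃∉T = ∣S∣<n⇒∃∉ T (ℕ.≤-reflexive (trans (cong suc ∣T∣≡) (sym order)))

  c : Fin n
  c = proj₁ ∃∉T

  ≢c⇒∈T : v ≢ c → v ∈ T
  ≢c⇒∈T {v} v≢c with ∈-insert⁻ {S = T} {w = c} (subst (v ∈_)
    (sym (∣p∣≡n⇒p≡⊤ (trans (∣insert∣ T (proj₂ ∃∉T)) (trans (cong suc ∣T∣≡) (sym order))))) ∈⊤)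
  ... | inj₁ v∈T = v∈T
  ... | inj₂ v≡c = contradiction v≡c v≢c

  -- Inverse of `label` on `T`. As a label consists of a colour and a rank, the colour classes of
  -- `T` become the partite sets.
  e : Fin (k * 2) → Fin n
  e i = proj₁ (label-surjective i)

  e∈T : ∀ i → e i ∈ T
  e∈T i = proj₁ (proj₂ (label-surjective i))

  label-e : ∀ i → label (e i) ≡ i
  label-e i = proj₂ (proj₂ (label-surjective i))

  e-label : v ≢ c → e (label v) ≡ v
  e-label v≢c = label-injective (e∈T _) (≢c⇒∈T v≢c) (label-e _)

  e-injective : Injective _≡_ _≡_ e
  e-injective {u} {v} eq = trans (sym (label-e u)) (trans (cong label eq) (label-e v))

  e≢c : ∀ i → e i ≢ c
  e≢c i eq = proj₂ ∃∉T (subst (_∈ T) eq (e∈T i))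

  class-e : ∀ i → class (e i) ≡ quotient 2 i
  class-e i = trans (sym (quotient-label (e i))) (cong (quotient 2) (label-e i))

  G₁ : Graph (Fin (k * 2))
  G₁ = record
    { Adj       = λ u v → Adj G (e u) (e v)
    ; adj?      = λ u v → adj? G (e u) (e v)
    ; symmetric = Graph.symmetric G
    ; irrefl    = λ u≡v → Graph.irrefl G (cong e u≡v)
    }

  G₁≅G-c : G₁ ≅ G [ ⊤ - c ]
  G₁≅G-c = record
    { bijection = mk↔ₛ′ (λ i → e i , x∈p∧x≢y⇒x∈p-y ∈⊤ (e≢c i)) (label ∘ proj₁)
        (λ (v , v∈) → ∃∈-≡ (e-label λ { refl → x∉S-x ⊤ v∈ })) label-e
    ; preserves = λ u v → mk⇔ id id
    }

  spanning : G₁ ⊑ completeMultipartite k 2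
  spanning {u} {v} u~v q≡q = class-isColouring (e∈T u) (e∈T v)
    (trans (class-e u) (trans q≡q (sym (class-e v)))) u~v

  noTriple₁ : NoIndependentTriple G₁
  noTriple₁ u≢v u≢w v≢w = noTriple (u≢v ∘ e-injective) (u≢w ∘ e-injective) (v≢w ∘ e-injective)

  α[G₁]≡2 : IsIndependenceNumber G₁ 2
  α[G₁]≡2 = record
    { attained = ⁅ zero ⁆ ∪ ⁅ mate k zero ⁆ ,
        (λ u v u∈ v∈ u~v → spanning {u} {v} u~v (trans (part u∈) (sym (part v∈)))) ,
        trans (∣insert∣ ⁅ zero ⁆ (mate-≢ k zero ∘ sym ∘ x∈⁅y⁆⇒x≡y zero))
          (cong suc (∣⁅x⁆∣≡1 {k * 2} zero))
    ; maximum  = λ S indep → Rank.∣S∣≤j*2 {G = G₁} noTriple₁ {f = const (zero {0})}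
        λ {u} {v} u∈S v∈S _ → indep u v u∈S v∈S
    }
    where
    part : ∀ {u} → u ∈ ⁅ zero ⁆ ∪ ⁅ mate k zero ⁆ → quotient {k} 2 u ≡ quotient 2 zero
    part u∈ with ∈-insert⁻ {S = ⁅ zero ⁆} {w = mate k zero} u∈
    ... | inj₁ u∈0 = cong (quotient {k} 2) (x∈⁅y⁆⇒x≡y zero u∈0)
    ... | inj₂ refl = quotient-mate k zero

  M : PerfectMatching (complement G₁)
  M = partiteMatching k G₁ spanning

  NonNeighbour : Fin (k * 2) → Set
  NonNeighbour v = ¬ ClosedNeighbourhood G c (e v)

  nonNeighbour : ∀ {v} → ¬ Adj G c (e v) → NonNeighbour v
  nonNeighbour c≁v (inj₁ v≡c) = e≢c _ v≡c
  nonNeighbour c≁v (inj₂ c~v) = c≁v c~v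

  -- The vertex `c` alone is a 1-colourable set smaller than the maximal ones, so some `w` not
  -- adjacent to `c` can be added.
  nonempty : ∃ NonNeighbour
  nonempty
    with w , w∉ , f , isColouring ← extend {⁅ c ⁆} (s≤s z≤n)
           (const zero , λ u∈ v∈ _ → Graph.irrefl G
             (trans (x∈⁅y⁆⇒x≡y c u∈) (sym (x∈⁅y⁆⇒x≡y c v∈))))
           (λ eq → contradiction (trans (sym (∣⁅x⁆∣≡1 c)) eq) λ ())
    with f c in fc | f w in fw
  ... | zero | zero = label w , nonNeighbour λ c~w →
    isColouring (∈-insertˡ (x∈⁅x⁆ c)) ∈-insertʳ (trans fc (sym fw))
      (subst (Adj G c) (e-label λ { refl → w∉ (x∈⁅x⁆ w) }) c~w)

  independent : Independent (complement G₁) NonNeighbour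
  independent u v u-c v-c (u≢v , u≁v) = u≁v (noTriple (≢-sym (e≢c u)) (≢-sym (e≢c v))
    (u≢v ∘ e-injective) (u-c ∘ inj₂) (v-c ∘ inj₂))

  -- Alternating paths to all vertices

  Reached : Fin (k * 2) → Set
  Reached v = Σ[ u ∈ Fin (k * 2) ] Σ[ w ∈ Fin (k * 2) ] Σ[ vs ∈ List (Fin (k * 2)) ]
    (NonNeighbour u × Matched M u w × IsAlternatingPath (complement G₁) M (u ∷ w ∷ vs) ×
     v List.∈ u ∷ w ∷ vs)

  mate-complement : ∀ u → Adj (complement G₁) (mate k u) u
  mate-complement u = ≢-sym (mate-≢ k u) , λ p~u → spanning {mate k u} {u} p~u (quotient-mate k u)

  module Trails (Y : Subset n) (y₀ : Fin (k * 2)) {j : ℕ} (f : Fin n → Fin j)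
    (isColouring : IsColouring G (Y ∪ ⁅ e y₀ ⁆) f) (∣Y₁∣≡ : ∣ Y ∪ ⁅ e y₀ ⁆ ∣ ≡ j * 2)
    (closed : ∀ {u} → e u ∈ Y → e (mate k u) ∈ Y) (y₀∉Y : e y₀ ∉ Y) where

    private
      Y₁ = Y ∪ ⁅ e y₀ ⁆

    -- As `Y` is closed under mates and lacks `y₀`, it lacks the mate of `y₀` too. A walk through
    -- `Y₁` therefore never returns to that end of the trail.
    e-mate-y₀∉Y₁ : e (mate k y₀) ∉ Y₁
    e-mate-y₀∉Y₁ m∈ with ∈-insert⁻ m∈
    ... | inj₁ m∈Y = y₀∉Y (subst (λ u → e u ∈ Y) (mate-involutive k y₀) (closed m∈Y))
    ... | inj₂ m≡y₀ = mate-≢ k y₀ (sym (e-injective m≡y₀))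

    -- A path from y to mate y₀ alternating between edges of M and colour classes of f. It
    -- contains the classmate of each of its vertices but y, so the one of y is new.
    record Trail (y z : Fin (k * 2)) (vs : List (Fin (k * 2))) : Set where
      private
        path : List (Fin (k * 2))
        path = y ∷ z ∷ vs
      field
        matched     : Matched M y z
        alternating : IsAlternatingPath (complement G₁) M path
        head∈Y₁     : e y ∈ Y₁
        y₀∈         : y₀ List.∈ path
        mate∈       : ∀ {u} → u List.∈ path → mate k u List.∈ path
        classmate∈  : ∀ {u} → u List.∈ path → u ≢ y → u ≢ mate k y₀ →
          ∃ λ v → v List.∈ path × v ≢ y × v ≢ u × e v ∈ Y₁ × f (e v) ≡ f (e u)

    -- If the classmate of the head `y` is `c`, then `y` is a non-neighbour of `c` and the trail is
    -- the required path. Otherwise the classmate and its mate are put in front. `visited` collects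
    -- these classmates and bounds the recursion.
    followTrail : ∀ {y z vs} (visited : Subset (k * 2)) → Acc _⊃_ visited →
      (∀ {u} → u ∈ visited → u List.∈ y ∷ z ∷ vs) → Trail y z vs →
      ∀ {v} → v List.∈ y ∷ z ∷ vs → Reached v
    followTrail {y} {z} {vs} visited (acc rec) visited⊆ trail {v} v∈ = cont
      (Rank.classmate {G = G} noTriple {f = f} isColouring ∣Y₁∣≡ head∈Y₁)
      where
      open Trail trail
      path = y ∷ z ∷ vs

      step-through : ∀ {x} → e x ∈ Y₁ → x ≢ y → f (e x) ≡ f (e y) → Reached v
      step-through {x} x∈Y₁ x≢y fx≡fy = followTrail (visited ∪ ⁅ x ⁆)
        (rec (⊂-insert (x∉ ∘ visited⊆))) visited⊆′ trail′ (there-twice v∈)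
        where
        x≢mate-y₀ : x ≢ mate k y₀
        x≢mate-y₀ refl = e-mate-y₀∉Y₁ x∈Y₁

        -- If `x` were on the trail, its classmate there, distinct from `y`, would form a class of
        -- three with `x` and `y`.
        x∉ : ¬ x List.∈ path
        x∉ x∈ with u , _ , u≢y , u≢x , u∈Y₁ , fu≡fx ← classmate∈ x∈ x≢y x≢mate-y₀ =
          u≢y (e-injective (Rank.classSize≤2 {G = G} noTriple {f = f} isColouring
            x∈Y₁ u∈Y₁ head∈Y₁ (sym fu≡fx) fx≡fy (u≢x ∘ sym ∘ e-injective) (x≢y ∘ e-injective)))

        x⁻ = mate k x

        x⁻∉ : ¬ x⁻ List.∈ path
        x⁻∉ x⁻∈ = x∉ (subst (List._∈ path) (mate-involutive k x) (mate∈ x⁻∈))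

        x⁻≢ : ∀ {u} → u List.∈ path → x⁻ ≢ u
        x⁻≢ u∈ refl = x⁻∉ u∈

        x⁻∈Y₁ : e x⁻ ∈ Y₁
        x⁻∈Y₁ with ∈-insert⁻ x∈Y₁
        ... | inj₁ x∈Y = ∈-insertˡ (closed x∈Y)
        ... | inj₂ x≡y₀ = contradiction (subst (List._∈ path) (sym (e-injective x≡y₀)) y₀∈) x∉

        there-twice : ∀ {u} → u List.∈ path → u List.∈ x⁻ ∷ x ∷ path
        there-twice u∈ = there (there u∈)

        visited⊆′ : ∀ {u} → u ∈ visited ∪ ⁅ x ⁆ → u List.∈ x⁻ ∷ x ∷ path
        visited⊆′ u∈ with ∈-insert⁻ u∈
        ... | inj₁ u∈visited = there-twice (visited⊆ u∈visited)
        ... | inj₂ refl = there (here refl)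

        alternating′ : IsAlternatingPath (complement G₁) M (x⁻ ∷ x ∷ path)
        alternating′ with (edges , unique) , alt ← alternating =
          (mate-complement x ∷ (x≢y , isColouring x∈Y₁ head∈Y₁ fx≡fy) ∷ edges ,
           (≢-sym (mate-≢ k x) ∷ All.tabulate x⁻≢) ∷ (All.tabulate λ { u∈ refl → x∉ u∈ }) ∷ unique) ,
          -- The edge from `x` to `y` is not in `M`, because the mate of `x` is not on the trail.
          step (λ { (_ , x≢y , q≡q) → x⁻≢ (here refl) (mate-unique k x x≢y q≡q) })
               (λ ((_ , x⁻x∉M) , _) → x⁻x∉M (≢-sym (mate-≢ k x) , quotient-mate k x))
               (step (λ { ((x≢y , q≡q) , _) → x⁻≢ (here refl) (mate-unique k x x≢y q≡q) })
                     (λ (_ , (_ , yz∉M)) → yz∉M matched)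
                     alt)

        mate∈′ : ∀ {u} → u List.∈ x⁻ ∷ x ∷ path → mate k u List.∈ x⁻ ∷ x ∷ path
        mate∈′ (here refl)         = there (here (mate-involutive k x))
        mate∈′ (there (here refl)) = here refl
        mate∈′ (there (there u∈))  = there (there (mate∈ u∈))

        classmate∈′ : ∀ {u} → u List.∈ x⁻ ∷ x ∷ path → u ≢ x⁻ → u ≢ mate k y₀ →
          ∃ λ v → v List.∈ x⁻ ∷ x ∷ path × v ≢ x⁻ × v ≢ u × e v ∈ Y₁ × f (e v) ≡ f (e u)
        classmate∈′ (here refl) x⁻≢x⁻ _ = contradiction refl x⁻≢x⁻
        classmate∈′ (there (here refl)) _ _ =
          y , there (there (here refl)) , ≢-sym (x⁻≢ (here refl)) , ≢-sym x≢y , head∈Y₁ , sym fx≡fy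
        classmate∈′ {u} (there (there u∈)) _ u≢mate-y₀ with u Fin.≟ y
        ... | yes refl = x , there (here refl) , mate-≢ k x , x≢y , x∈Y₁ , fx≡fy
        ... | no u≢y with v , v∈ , _ , v≢u , v∈Y₁ , fv≡fu ← classmate∈ u∈ u≢y u≢mate-y₀ =
          v , there (there v∈) , ≢-sym (x⁻≢ v∈) , v≢u , v∈Y₁ , fv≡fu

        trail′ : Trail x⁻ x path
        trail′ = record
          { matched     = ≢-sym (mate-≢ k x) , quotient-mate k x
          ; alternating = alternating′
          ; head∈Y₁     = x⁻∈Y₁
          ; y₀∈         = there (there y₀∈)
          ; mate∈       = mate∈′
          ; classmate∈  = classmate∈′
          }

      cont : (∃ λ t → t ∈ Y₁ × t ≢ e y × f t ≡ f (e y)) → Reached v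
      cont (t , t∈Y₁ , t≢y , ft≡fy) with t Fin.≟ c
      ... | yes refl = y , z , vs , nonNeighbour (isColouring t∈Y₁ head∈Y₁ ft≡fy) ,
        matched , alternating , v∈
      ... | no t≢c = step-through {label t} (subst (_∈ Y₁) (sym et≡t) t∈Y₁)
        (λ { refl → t≢y (sym et≡t) }) (trans (cong f et≡t) ft≡fy)
        where
        et≡t = e-label t≢c

    reached : Reached y₀ × Reached (mate k y₀)
    reached = start (here refl) , start (there (here refl))
      where
      mate∈ : ∀ {u} → u List.∈ y₀ ∷ mate k y₀ ∷ [] → mate k u List.∈ y₀ ∷ mate k y₀ ∷ []
      mate∈ (here refl)         = there (here refl)
      mate∈ (there (here refl)) = here (mate-involutive k y₀)

      classmate∈ : ∀ {u} → u List.∈ y₀ ∷ mate k y₀ ∷ [] → u ≢ y₀ → u ≢ mate k y₀ →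
        ∃ λ v → v List.∈ y₀ ∷ mate k y₀ ∷ [] × v ≢ y₀ × v ≢ u × e v ∈ Y₁ × f (e v) ≡ f (e u)
      classmate∈ (here u≡)         u≢y₀ _ = contradiction u≡ u≢y₀
      classmate∈ (there (here u≡)) _ u≢m  = contradiction u≡ u≢m

      start : ∀ {v} → v List.∈ y₀ ∷ mate k y₀ ∷ [] → Reached v
      start = followTrail ⊥ (⊃-wellFounded ⊥) (λ u∈⊥ → contradiction u∈⊥ ∉⊥) record
        { matched     = mate-≢ k y₀ , sym (quotient-mate k y₀)
        ; alternating = ((Graph.symmetric (complement G₁) {mate k y₀} {y₀} (mate-complement y₀) ∷ [-]) ,
                         (mate-≢ k y₀ ∷ []) ∷ [] ∷ []) , [-,-]
        ; head∈Y₁     = ∈-insertʳ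
        ; y₀∈         = here refl
        ; mate∈       = mate∈
        ; classmate∈  = classmate∈
        }

  record ReachedSet (m : ℕ) : Set where
    field
      Y          : Subset n
      c∈Y        : c ∈ Y
      ∣Y∣≡       : ∣ Y ∣ ≡ suc (m * 2)
      colourable : ColourableOn G (suc m) Y
      closed     : ∀ {u} → e u ∈ Y → e (mate k u) ∈ Y
      reached    : ∀ {u} → e u ∈ Y → Reached u

  reachedSet : ∀ m → m ≤ k → ReachedSet m
  reachedSet 0 _ = record
    { Y          = ⁅ c ⁆
    ; c∈Y        = x∈⁅x⁆ c
    ; ∣Y∣≡       = ∣⁅x⁆∣≡1 c
    ; colourable = const zero , λ u∈ v∈ _ → Graph.irrefl G
                     (trans (x∈⁅y⁆⇒x≡y c u∈) (sym (x∈⁅y⁆⇒x≡y c v∈)))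
    ; closed     = λ u∈ → contradiction (x∈⁅y⁆⇒x≡y c u∈) (e≢c _)
    ; reached    = λ u∈ → contradiction (x∈⁅y⁆⇒x≡y c u∈) (e≢c _)
    }
  -- `Y` has 2m+1 vertices, one fewer than the maximal sets for m+1 colours.
  reachedSet (suc m) m<k = go (extend m<k colourable λ ∣Y∣≡′ →
      ℕ.<⇒≢ (ℕ.n<1+n (suc (m * 2))) (trans (sym ∣Y∣≡) ∣Y∣≡′))
    where
    open ReachedSet (reachedSet m (ℕ.<⇒≤ m<k))

    go : Extendable G (suc m) Y → ReachedSet (suc m)
    go (w , w∉Y , f , isColouring) = record
      { Y          = Y₂
      ; c∈Y        = ∈-insertˡ (∈-insertˡ c∈Y)
      ; ∣Y∣≡       = trans (∣insert∣ Y₁ T.e-mate-y₀∉Y₁) (cong suc ∣Y₁∣≡)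
      ; colourable = g , g-isColouring
      ; closed     = closed₂
      ; reached    = reached₂
      }
      where
      y₀ = label w

      ey₀≡w : e y₀ ≡ w
      ey₀≡w = e-label λ { refl → w∉Y c∈Y }

      y₀∉Y : e y₀ ∉ Y
      y₀∉Y = w∉Y ∘ subst (_∈ Y) ey₀≡w

      Y₁ = Y ∪ ⁅ e y₀ ⁆
      Y₂ = Y₁ ∪ ⁅ e (mate k y₀) ⁆

      ∣Y₁∣≡ : ∣ Y₁ ∣ ≡ suc m * 2
      ∣Y₁∣≡ = trans (∣insert∣ Y y₀∉Y) (cong suc ∣Y∣≡)

      isColouring₁ : IsColouring G Y₁ f
      isColouring₁ = subst (λ w → IsColouring G (Y ∪ ⁅ w ⁆) f) (sym ey₀≡w) isColouring

      module T = Trails Y y₀ f isColouring₁ ∣Y₁∣≡ closed y₀∉Y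

      old : ∀ {u} → e u ∈ Y₂ → e u ∈ Y ⊎ u ≡ y₀ ⊎ u ≡ mate k y₀
      old u∈ with ∈-insert⁻ {S = Y₁} u∈
      ... | inj₂ u≡m = inj₂ (inj₂ (e-injective u≡m))
      ... | inj₁ u∈Y₁ with ∈-insert⁻ {S = Y} u∈Y₁
      ... | inj₂ u≡y₀ = inj₂ (inj₁ (e-injective u≡y₀))
      ... | inj₁ u∈Y = inj₁ u∈Y

      closed₂ : ∀ {u} → e u ∈ Y₂ → e (mate k u) ∈ Y₂
      closed₂ u∈ with old u∈
      ... | inj₁ u∈Y = ∈-insertˡ (∈-insertˡ (closed u∈Y))
      ... | inj₂ (inj₁ refl) = ∈-insertʳ
      ... | inj₂ (inj₂ refl) = ∈-insertˡ
            (subst (λ u → e u ∈ Y₁) (sym (mate-involutive k y₀)) ∈-insertʳ)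

      reached₂ : ∀ {u} → e u ∈ Y₂ → Reached u
      reached₂ u∈ with old u∈
      ... | inj₁ u∈Y = reached u∈Y
      ... | inj₂ (inj₁ refl) = proj₁ T.reached
      ... | inj₂ (inj₂ refl) = proj₂ T.reached

      -- Shifting the old colours frees colour zero for `y₀` and its mate, which are not adjacent.
      f₀ : Fin n → Fin (suc (suc m))
      f₀ = Fin.suc ∘ proj₁ colourable

      f₁ = updateAt f₀ (e y₀) (const zero)
      g  = updateAt f₁ (e (mate k y₀)) (const zero)

      f₁-isColouring : IsColouring G Y₁ f₁
      f₁-isColouring = insertInto G
        (λ u∈ v∈ eq → proj₂ colourable u∈ v∈ (Fin.suc-injective eq)) λ _ _ ()

      g-isColouring : IsColouring G Y₂ g
      g-isColouring = insertInto G f₁-isColouring free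
        where
        free : ∀ {u} → u ∈ Y₁ → u ≢ e (mate k y₀) → f₁ u ≡ zero → ¬ Adj G (e (mate k y₀)) u
        free {u} u∈Y₁ _ f₁u≡0 with u Fin.≟ e y₀
        ... | yes refl = proj₂ (mate-complement y₀)
        ... | no u≢y₀ = contradiction (trans (sym f₁u≡0) (updateAt-minimal u (e y₀) f₀ u≢y₀)) λ ()

  formedByConstruction : FormedByConstruction k G
  formedByConstruction = record
    { c           = c
    ; G₁          = G₁
    ; G₁≅G-c      = G₁≅G-c
    ; spanning    = λ {u} {v} → spanning {u} {v}
    ; α[G₁]≡2     = α[G₁]≡2
    ; nonempty    = nonempty
    ; independent = independent
    -- For m = k the set `Y` contains every vertex. Paths reach even the vertices of `S`, so the
    -- second alternative always holds.
    ; dominating  = λ v → inj₂ (reached (subst (e v ∈_) (sym Y≡⊤) ∈⊤))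
    }
    where
    open ReachedSet (reachedSet k ℕ.≤-refl)
    Y≡⊤ : Y ≡ ⊤
    Y≡⊤ = ∣p∣≡n⇒p≡⊤ (trans ∣Y∣≡ (sym order))

theorem5 : ∀ (k : ℕ) → k ≥ 1 → ∀ {n : ℕ} (G : Graph (Fin n)) → Connected G →
    WellHuedWithSequence G (applyUpTo (λ i → 2 * suc i) k ∷ʳ (2 * k + 1)) ⇔
    FormedByConstruction k G
theorem5 (suc _) _ _ _ = mk⇔ FromSequence.formedByConstruction FromConstruction.wellHuedWithSequence
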